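{- For any tree $T$ of order $n\geq 5$, we have $\text{max-sep}_{RB}(T)\leq\frac{2n}{3}$.
   Context: $N[x]$ denotes the closed neighborhood of $x$. A red-blue coloring of a graph $G$ is a map $c:V(G)\to\{\text{red},\text{blue}\}$. A red-blue separating set of $(G,c)$ is a set $S\subseteq V(G)$ such that $N[r]\cap S\neq N[b]\cap S$ for every red vertex $r$ and every blue vertex $b$. For a twin-free graph $G$ (no two distinct vertices have the same closed neighborhood; this holds for every tree on at least $3$ vertices), $\mathrm{sep}_{RB}(G,c)$ is the smallest size of a red-blue separating set of $(G,c)$, and $\text{max-sep}_{RB}(G)$ is the maximum of $\mathrm{sep}_{RB}(G,c)$ over all red-blue colorings $c$ of $G$. -}

module Defs where

open import Data.Fin using (Fin; _≟_)
open import Data.Fin.Subset using (Subset; _∩_; ∣_∣)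
open import Data.List using (List; _∷_; []; _++_; length)
open import Data.List.Relation.Unary.Linked using (Linked)
open import Data.List.Relation.Unary.Unique.Propositional using (Unique)
open import Data.Nat using (ℕ; NonZero; _≤_)
open import Data.Product using (_×_; ∃-syntax)
open import Data.Vec using (tabulate)
open import Level using (0ℓ)
open import Relation.Binary using (Rel; Symmetric; Irreflexive; Decidable)
open import Relation.Binary.Construct.Closure.ReflexiveTransitive using (Star)
open import Relation.Binary.PropositionalEquality using (_≡_; _≢_)
open import Relation.Nullary using (¬_; does; _⊎-dec_)

-- Finite simple graphs of order n, with vertex set Fin n.
record Graph (n : ℕ) : Set₁ where
  infix 4 _~_ _~?_
  field
    _~_      : Rel (Fin n) 0ℓ
    _~?_     : Decidable _~_
    ~-sym    : Symmetric _~_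
    ~-irrefl : Irreflexive _≡_ _~_

  N[_] : Fin n → Subset n
  N[ x ] = tabulate λ y → does ((y ≟ x) ⊎-dec (x ~? y))

  Connected : Set
  Connected = ∀ u v → Star _~_ u v

  -- The cycle x , xs₁ , … , xsₖ , x with k + 1 ≥ 3 distinct vertices.
  IsCycle : Fin n → List (Fin n) → Set
  IsCycle x xs =
    2 ≤ length xs × Unique (x ∷ xs) × Linked _~_ (x ∷ xs ++ x ∷ [])

  Acyclic : Set
  Acyclic = ∀ x xs → ¬ IsCycle x xs

  IsTree : Set
  IsTree = NonZero n × Connected × Acyclic

data Color : Set where
  red blue : Color

Coloring : ℕ → Set
Coloring n = Fin n → Color

IsMinimum IsMaximum : (ℕ → Set) → ℕ → Set
IsMinimum P m = P m × (∀ k → P k → m ≤ k)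
IsMaximum P m = P m × (∀ k → P k → k ≤ m)

module _ {n : ℕ} (G : Graph n) where
  open Graph G

  Separating : Coloring n → Subset n → Set
  Separating c S =
    ∀ r b → c r ≡ red → c b ≡ blue → N[ r ] ∩ S ≢ N[ b ] ∩ S

  -- sep_RB(G,c) and max-sep_RB(G) are given as functional relations, since
  -- without twin-freeness some coloring may have no separating set at all:
  -- "sep_RB(G,c) = m" is  SepRB c m,  and  "max-sep_RB(G) = m" is  MaxSepRB m.
  SepRB : Coloring n → ℕ → Set
  SepRB c = IsMinimum λ k → ∃[ S ] Separating c S × ∣ S ∣ ≡ k

  MaxSepRB : ℕ → Set
  MaxSepRB = IsMaximum λ k → ∃[ c ] SepRB c k

{-# OPTIONS --safe #-}
-- Let s be the number of support vertices of the tree.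
-- All vertices except one leaf at each support vertex form a set of size n − s
-- that distinguishes any two vertices (here n ≥ 5 excludes the path on four
-- vertices).  There are also two red-blue separating sets of total size at most
-- n + s, so one of the three sets has size at most 2n/3.
-- The two sets start from the two sides of the bipartition, since two vertices
-- of a tree have at most one common neighbour.  What this fails to tell apart is
-- a support vertex u and its leaves.  If u has both leaves of its own colour and
-- leaves of the other colour, both sets contain u, the former leaves go to the
-- set of u's side and the latter to the other set.  Otherwise all leaves of u
-- stay on their own side, and the set of u's side gains a non-leaf neighbour
-- of u.  Such a neighbour exists unless the tree is a star, which is treated
-- separately.
module Submission where

open import Defs
open import Data.Bool using (Bool; true; false; not; _xor_)
open import Data.Bool.Properties using (not-involutive; ¬-not; xor-same; not-distribˡ-xor; not-distribʳ-xor)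
  renaming (_≟_ to _≟ᵇ_)
open import Data.Fin using (Fin; zero; suc; _≟_; fromℕ<)
open import Data.Fin.Properties using (any?; all?; ¬∀⟶∃¬; injective⇒≤)
open import Data.Fin.Subset using (Subset; _∈_; _⊆_; _∩_; _∪_; ∁; ⁅_⁆; ⊥; ⊤; ∣_∣; inside; outside)
open import Data.Fin.Subset.Properties
open import Data.List as List using (List; []; _∷_; _++_; length)
open import Data.List.Membership.Propositional using () renaming (_∈_ to _∈ˡ_)
open import Data.List.Relation.Binary.Subset.Propositional using () renaming (_⊆_ to _⊆ˡ_)
open import Data.List.Relation.Unary.All using (All; []; _∷_)
open import Data.List.Relation.Unary.All.Properties using (anti-mono; All¬⇒¬Any; ¬Any⇒All¬)
open import Data.List.Relation.Unary.AllPairs using ([]; _∷_)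
open import Data.List.Relation.Unary.Any using (here; there; index)
open import Data.List.Relation.Unary.Any.Properties using (lookup-index)
open import Data.List.Relation.Unary.Linked using (Linked; [-]; _∷_)
open import Data.List.Relation.Unary.Unique.Propositional using (Unique)
open import Data.Nat using (ℕ; zero; suc; _≤_; _<_; _≥_; _*_; _+_; _∸_; z≤n; s≤s; _≤?_)
  renaming (_≟_ to _≟ⁿ_)
open import Data.Nat.Induction using (<-rec)
open import Data.Nat.Properties
  using (≤-refl; ≤-trans; ≤-reflexive; ≤-total; <⇒≱; ≰⇒>; ≮⇒≥; +-suc; +-comm; +-assoc; +-mono-≤;
  +-mono-<; +-monoʳ-≤; *-monoʳ-≤; *-distribˡ-+; anyUpTo?; m∸n+n≡m; +-commutativeSemigroup; module ≤-Reasoning)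
open import Data.Product using (Σ; _×_; _,_; proj₁; proj₂; ∃; ∃-syntax)
open import Data.Sum using (_⊎_; inj₁; inj₂; [_,_]′; swap)
open import Data.Vec as Vec using ([]; _∷_; lookup; tabulate)
open import Data.Vec.Properties using (lookup∘tabulate; []=⇒lookup; lookup⇒[]=; ≡-dec)
open import Function using (_∘_)
open import Relation.Binary.Construct.Closure.ReflexiveTransitive using (Star; ε; _◅_)
open import Relation.Binary.PropositionalEquality using (_≡_; _≢_; refl; sym; trans; cong; cong₂; subst; ≢-sym)
open import Relation.Nullary using (¬_; Dec; yes; no; does; contradiction; ¬?; _×-dec_; _⊎-dec_; _→-dec_)
open import Relation.Nullary.Decidable using (dec-true; decidable-stable)
open import Relation.Unary using (Decidable)

open import Algebra.Properties.CommutativeSemigroup +-commutativeSemigroup using (interchange)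
import Data.List.Membership.DecPropositional as DecMembership

private variable
  k n : ℕ

-- Minima, maxima over subsets, and averaging.

least : {Q : ℕ → Set} → Decidable Q → ∀ k → Q k → ∃ (IsMinimum Q)
least {Q} Q? = <-rec (λ k → Q k → ∃ (IsMinimum Q)) λ k rec qk →
  case-below (anyUpTo? Q? k) rec qk
  where
  case-below : ∀ {k} → Dec (∃ λ j → j < k × Q j) →
    (∀ {j} → j < k → Q j → ∃ (IsMinimum Q)) → Q k → ∃ (IsMinimum Q)
  case-below (yes (j , j<k , qj)) rec qk = rec j<k qj
  case-below {k} (no none) rec qk =
    k , qk , λ j qj → ≮⇒≥ λ j<k → none (j , j<k , qj)

maximalSubset : (f : Subset n → ℕ) → ∃[ S ] (∀ T → f T ≤ f S)
maximalSubset {zero} f = [] , λ { [] → ≤-refl }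
maximalSubset {suc n} f with maximalSubset (f ∘ (inside ∷_)) | maximalSubset (f ∘ (outside ∷_))
... | S , S-max | T , T-max with ≤-total (f (inside ∷ S)) (f (outside ∷ T))
... | inj₁ S≤T = outside ∷ T , λ
  { (inside ∷ U) → ≤-trans (S-max U) S≤T ; (outside ∷ U) → T-max U }
... | inj₂ T≤S = inside ∷ S , λ
  { (inside ∷ U) → S-max U ; (outside ∷ U) → ≤-trans (T-max U) T≤S }

some-≤-average : ∀ a b c n → a + b + c ≤ 2 * n →
  3 * a ≤ 2 * n ⊎ 3 * b ≤ 2 * n ⊎ 3 * c ≤ 2 * n
some-≤-average a b c n sum≤ with 3 * a ≤? 2 * n | 3 * b ≤? 2 * n | 3 * c ≤? 2 * n
... | yes a≤ | _ | _ = inj₁ a≤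
... | no _ | yes b≤ | _ = inj₂ (inj₁ b≤)
... | no _ | no _ | yes c≤ = inj₂ (inj₂ c≤)
... | no a≰ | no b≰ | no c≰ = contradiction (*-monoʳ-≤ 3 sum≤) (<⇒≱ (begin-strict
  3 * (2 * n)                  ≡⟨⟩
  2 * n + (2 * n + (2 * n + 0)) ≡⟨ cong (λ k → 2 * n + (2 * n + k)) (+-comm (2 * n) 0) ⟩
  2 * n + (2 * n + 2 * n)      ≡⟨ +-assoc (2 * n) (2 * n) (2 * n) ⟨
  2 * n + 2 * n + 2 * n        <⟨ +-mono-< (+-mono-< (≰⇒> a≰) (≰⇒> b≰)) (≰⇒> c≰) ⟩
  3 * a + 3 * b + 3 * c        ≡⟨ cong (_+ 3 * c) (*-distribˡ-+ 3 a b) ⟨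
  3 * (a + b) + 3 * c          ≡⟨ *-distribˡ-+ 3 (a + b) c ⟨
  3 * (a + b + c)              ∎))
  where open ≤-Reasoning

-- Cardinalities of subsets

⟦_⟧ : {P : Fin n → Set} → Decidable P → Subset n
⟦ P? ⟧ = tabulate (does ∘ P?)

∈⟦⟧⁺ : {P : Fin n → Set} (P? : Decidable P) → ∀ {v} → P v → v ∈ ⟦ P? ⟧
∈⟦⟧⁺ P? {v} Pv = lookup⇒[]= v _ (trans (lookup∘tabulate (does ∘ P?) v) (dec-true (P? v) Pv))

∈⟦⟧⁻ : {P : Fin n → Set} (P? : Decidable P) → ∀ {v} → v ∈ ⟦ P? ⟧ → P v
∈⟦⟧⁻ P? {v} v∈ with P? v | trans (sym (lookup∘tabulate (does ∘ P?) v)) ([]=⇒lookup v∈)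
... | yes Pv | _ = Pv
... | no _ | ()

class : (Fin n → Bool) → Bool → Subset n
class f q = ⟦ (λ v → f v ≟ᵇ q) ⟧

∣∩class∣ : (X : Subset n) (f : Fin n → Bool) →
  ∣ X ∩ class f true ∣ + ∣ X ∩ class f false ∣ ≡ ∣ X ∣
∣∩class∣ [] f = refl
∣∩class∣ (outside ∷ X) f = ∣∩class∣ X (f ∘ suc)
∣∩class∣ (inside ∷ X) f with f zero
... | true = cong suc (∣∩class∣ X (f ∘ suc))
... | false = trans (+-suc _ _) (cong suc (∣∩class∣ X (f ∘ suc)))

∣class∣ : (f : Fin n → Bool) → ∣ class f true ∣ + ∣ class f false ∣ ≡ n
∣class∣ {n} f = trans
  (sym (cong₂ (λ X Y → ∣ X ∣ + ∣ Y ∣) (∩-identityˡ (class f true)) (∩-identityˡ (class f false))))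
  (trans (∣∩class∣ ⊤ f) (∣⊤∣≡n n))

∣p∪q∣≤∣p∣+∣q∣ : (p q : Subset n) → ∣ p ∪ q ∣ ≤ ∣ p ∣ + ∣ q ∣
∣p∪q∣≤∣p∣+∣q∣ [] [] = z≤n
∣p∪q∣≤∣p∣+∣q∣ (outside ∷ p) (outside ∷ q) = ∣p∪q∣≤∣p∣+∣q∣ p q
∣p∪q∣≤∣p∣+∣q∣ (outside ∷ p) (inside ∷ q) =
  ≤-trans (s≤s (∣p∪q∣≤∣p∣+∣q∣ p q)) (≤-reflexive (sym (+-suc _ _)))
∣p∪q∣≤∣p∣+∣q∣ (inside ∷ p) (x ∷ q) =
  s≤s (≤-trans (∣p∪q∣≤∣p∣+∣q∣ p q) (+-monoʳ-≤ ∣ p ∣ (∣p∣≤∣x∷p∣ x q)))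

image : (Fin k → Fin n) → Subset k → Subset n
image f [] = ⊥
image f (outside ∷ X) = image (f ∘ suc) X
image f (inside ∷ X) = ⁅ f zero ⁆ ∪ image (f ∘ suc) X

∈-image : (f : Fin k → Fin n) (X : Subset k) → ∀ {x} → x ∈ X → f x ∈ image f X
∈-image f (inside ∷ X) {zero} _ = x∈p∪q⁺ (inj₁ (x∈⁅x⁆ (f zero)))
∈-image f (inside ∷ X) {suc x} (Vec.there x∈X) = x∈p∪q⁺ (inj₂ (∈-image (f ∘ suc) X x∈X))
∈-image f (outside ∷ X) {suc x} (Vec.there x∈X) = ∈-image (f ∘ suc) X x∈X

∣image∣≤ : (f : Fin k → Fin n) (X : Subset k) → ∣ image f X ∣ ≤ ∣ X ∣
∣image∣≤ {n = n} f [] = ≤-reflexive (∣⊥∣≡0 n)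
∣image∣≤ f (outside ∷ X) = ∣image∣≤ (f ∘ suc) X
∣image∣≤ f (inside ∷ X) = ≤-trans (∣p∪q∣≤∣p∣+∣q∣ ⁅ f zero ⁆ (image (f ∘ suc) X))
  (+-mono-≤ (≤-reflexive (∣⁅x⁆∣≡1 (f zero))) (∣image∣≤ (f ∘ suc) X))

-- Trees are bipartite and contain no 4-cycles

module _ (G : Graph n) (acyclic : Graph.Acyclic G) where
  open Graph G
  open DecMembership (_≟_ {n}) using () renaming (_∈?_ to _∈ˡ?_)

  no-4-cycle : ∀ {x y z w} → x ≢ y → z ≢ w → x ~ z → x ~ w → y ~ z → ¬ y ~ w
  no-4-cycle {x} {y} {z} {w} x≢y z≢w x~z x~w y~z y~w = acyclic x (z ∷ y ∷ w ∷ [])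
    ( s≤s (s≤s z≤n)
    , ((λ x≡z → ~-irrefl x≡z x~z) ∷ x≢y ∷ (λ x≡w → ~-irrefl x≡w x~w) ∷ [])
      ∷ ((λ z≡y → ~-irrefl (sym z≡y) y~z) ∷ z≢w ∷ [])
      ∷ ((λ y≡w → ~-irrefl y≡w y~w) ∷ [])
      ∷ [] ∷ []
    , x~z ∷ ~-sym y~z ∷ y~w ∷ ~-sym x~w ∷ [-])

  -- Unlike `Star`, a walk carries the list of its vertices after the start, so that repetition-free
  -- walks can be closed up into cycles.
  data Walk : Fin n → List (Fin n) → Fin n → Set where
    []  : ∀ {x} → Walk x [] x
    _∷_ : ∀ {x y v ys} → x ~ y → Walk y ys v → Walk x (y ∷ ys) v

  last∈ : ∀ {x y ys v} → Walk x (y ∷ ys) v → v ∈ˡ y ∷ ys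
  last∈ (_ ∷ []) = here refl
  last∈ (_ ∷ w@(_ ∷ _)) = there (last∈ w)

  -- The walk is cut just before its visit to `x`; appending `x` to the rest closes the cycle that
  -- `erase-loops` refutes.
  walk-until : ∀ {x z zs v} → Walk z zs v → x ∈ˡ zs → Unique (z ∷ zs) →
    ∃[ as ] (as ⊆ˡ zs × Linked _~_ (z ∷ as ++ x ∷ []) × Unique (z ∷ as) × All (x ≢_) (z ∷ as))
  walk-until (z~x ∷ _) (here refl) ((z≢x ∷ _) ∷ _) =
    [] , (λ ()) , z~x ∷ [-] , [] ∷ [] , ≢-sym z≢x ∷ []
  walk-until (z~y ∷ w) (there x∈) ((z≢y ∷ z≢) ∷ u) with walk-until w x∈ u
  ... | as , as⊆ , l , u′ , x≢ = _ ∷ as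
      , (λ { (here eq) → here eq ; (there i) → there (as⊆ i) })
      , z~y ∷ l
      , (z≢y ∷ anti-mono as⊆ z≢) ∷ u′
      , (λ { refl → All¬⇒¬Any z≢ x∈ }) ∷ x≢

  parity : List (Fin n) → Bool
  parity [] = false
  parity (_ ∷ xs) = not (parity xs)

  parity* : ∀ {u v} → Star _~_ u v → Bool
  parity* ε = false
  parity* (_ ◅ w) = not (parity* w)

  -- Loop erasure keeps the parity: as there are no cycles, the only loops
  -- that ever need to be removed are of the form x ~ y ~ x.
  erase-loops : ∀ {u v} (w : Star _~_ u v) →
    ∃[ zs ] (Walk u zs v × Unique (u ∷ zs) × parity zs ≡ parity* w)
  erase-loops ε = [] , [] , [] ∷ [] , refl
  erase-loops {u} (_◅_ {j = y} u~y w) with erase-loops w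
  ... | zs , walk , uniq , eq with u ∈ˡ? zs
  ... | no u∉ = y ∷ zs , u~y ∷ walk , ((λ u≡y → ~-irrefl u≡y u~y) ∷ ¬Any⇒All¬ zs u∉)
    ∷ uniq , cong not eq
  erase-loops {u} (u~y ◅ w) | _ , (_ ∷ walk) , (_ ∷ uniq) , eq | yes (here refl) =
    _ , walk , uniq , trans (sym (not-involutive _)) (cong not eq)
  erase-loops {u} (_◅_ {j = y} u~y w) | _ , (_∷_ {y = z} y~z walk) , ((y≢z ∷ y≢) ∷ uniq) , _ | yes (there u∈)
    with walk-until walk u∈ uniq
  ... | as , as⊆ , l , uniq′ , u≢ = contradiction
    ( s≤s (s≤s z≤n)
    , ((λ u≡y → ~-irrefl u≡y u~y) ∷ u≢) ∷ (y≢z ∷ anti-mono as⊆ y≢) ∷ uniq′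
    , u~y ∷ y~z ∷ l)
    (acyclic u (y ∷ z ∷ as))

  -- A repetition-free walk from `u` to `u` is empty, since any step would make `u` recur as the
  -- last vertex; and loop erasure keeps the parity.
  closed-even : ∀ {u} (w : Star _~_ u u) → parity* w ≡ false
  closed-even w with erase-loops w
  ... | [] , _ , _ , eq = sym eq
  ... | _ ∷ _ , walk , u≢ ∷ _ , _ = contradiction (last∈ walk) (All¬⇒¬Any u≢)

  -- The edges of `w` are moved one by one, reversed, to the front of `w′`; lengths add modulo 2.
  reverse-append : ∀ {r u v} (w : Star _~_ r u) (w′ : Star _~_ r v) →
    Σ (Star _~_ u v) λ w″ → parity* w″ ≡ parity* w xor parity* w′
  reverse-append ε w′ = w′ , refl
  reverse-append (e ◅ w) w′ with reverse-append w (~-sym e ◅ w′)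
  ... | w″ , eq = w″ , trans eq (trans (sym (not-distribʳ-xor (parity* w) _)) (not-distribˡ-xor (parity* w) _))

  -- The side of `v` is the parity of the given walk from `r` to `v`. If adjacent vertices had equal
  -- sides, their walks and the joining edge would form a closed walk of odd length.
  bipartite : Fin n → Graph.Connected G → ∃[ p ] (∀ {u v} → u ~ v → p u ≢ p v)
  bipartite r connected = (λ v → parity* (connected r v)) , λ {u} {v} u~v pu≡pv →
    let w , eq = reverse-append (connected r u) (connected r v)
        even = closed-even (~-sym u~v ◅ w)
        same = trans eq (trans (cong (_xor _) pu≡pv) (xor-same (parity* (connected r v))))
    in contradiction (trans (sym (cong not same)) even) λ ()

∣∪∣+∣∪∣≤ : (X X′ Y Y′ : Subset n) → ∀ {k l} → ∣ X ∣ + ∣ X′ ∣ ≤ k → ∣ Y ∣ + ∣ Y′ ∣ ≤ l →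
  ∣ X ∪ Y ∣ + ∣ X′ ∪ Y′ ∣ ≤ k + l
∣∪∣+∣∪∣≤ X X′ Y Y′ {k} {l} ≤k ≤l = begin
  ∣ X ∪ Y ∣ + ∣ X′ ∪ Y′ ∣             ≤⟨ +-mono-≤ (∣p∪q∣≤∣p∣+∣q∣ X Y) (∣p∪q∣≤∣p∣+∣q∣ X′ Y′) ⟩
  ∣ X ∣ + ∣ Y ∣ + (∣ X′ ∣ + ∣ Y′ ∣)   ≡⟨ interchange (∣ X ∣) (∣ Y ∣) (∣ X′ ∣) (∣ Y′ ∣) ⟩
  ∣ X ∣ + ∣ X′ ∣ + (∣ Y ∣ + ∣ Y′ ∣)   ≤⟨ +-mono-≤ ≤k ≤l ⟩
  k + l                               ∎
  where
  open ≤-Reasoning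

-- Small distinguishing sets

module Distinguishing (G : Graph n) where
  open Graph G

  Near : Fin n → Fin n → Set
  Near x z = z ≡ x ⊎ x ~ z

  near? : ∀ x → Decidable (Near x)
  near? x z = (z ≟ x) ⊎-dec (x ~? z)

  -- A constructive form of the inequality in `Separating`: a witness in `S` that lies in exactly
  -- one of the two closed neighbourhoods.
  Resolves Distinguishes : Subset n → Fin n → Fin n → Set
  Resolves S x y = ∃[ z ] (z ∈ S × Near x z × ¬ Near y z)
  Distinguishes S x y = Resolves S x y ⊎ Resolves S y x

  distinguishes⇒≢ : ∀ {S x y} → Distinguishes S x y → N[ x ] ∩ S ≢ N[ y ] ∩ S
  distinguishes⇒≢ = [ resolves⇒≢ , (λ r → resolves⇒≢ r ∘ sym) ]′
    where
    resolves⇒≢ : ∀ {S x y} → Resolves S x y → N[ x ] ∩ S ≢ N[ y ] ∩ S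
    resolves⇒≢ {S} {x} {y} (z , z∈S , near , ¬near) eq = ¬near (∈⟦⟧⁻ (near? y)
      (proj₁ (x∈p∩q⁻ N[ y ] S (subst (z ∈_) eq (x∈p∩q⁺ (∈⟦⟧⁺ (near? x) near , z∈S))))))

-- Leaves and support vertices in a tree of order at least 5.

module _ (G : Graph n) (acyclic : Graph.Acyclic G) (connected : Graph.Connected G) (n≥5 : n ≥ 5) where
  open Graph G
  open Distinguishing G

  closed⇒full : {P : Fin n → Set} → (∀ {u v} → P u → u ~ v → P v) → ∀ {u} → P u → ∀ v → P v
  closed⇒full {P} closed {u} Pu v = go (connected u v) Pu
    where
    go : ∀ {u v} → Star _~_ u v → P u → P v
    go ε Pu = Pu
    go (u~w ◅ w) Pu = go w (closed Pu u~w)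

  -- By connectedness such a list contains every vertex, and positions in it give an injection from
  -- the vertices. This is how `n ≥ 5` excludes small exceptional trees.
  closed⇒long : ∀ xs → (∀ {u v} → u ∈ˡ xs → u ~ v → v ∈ˡ xs) → ∀ {u} → u ∈ˡ xs → n ≤ length xs
  closed⇒long xs closed u∈ = injective⇒≤ {f = λ v → index (all v)} λ {v} {w} eq →
    trans (lookup-index (all v)) (trans (cong (List.lookup xs) eq) (sym (lookup-index (all w))))
    where
    all : ∀ v → v ∈ˡ xs
    all = closed⇒full closed u∈

  private
    parity-colouring : ∃[ p ] (∀ {u v} → u ~ v → p u ≢ p v)
    parity-colouring = bipartite G acyclic (fromℕ< {0} (≤-trans (s≤s z≤n) n≥5)) connected

  p : Fin n → Bool
  p = proj₁ parity-colouring

  p-alternates : ∀ {u v} → u ~ v → p v ≡ not (p u)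
  p-alternates u~v = ¬-not (proj₂ parity-colouring (~-sym u~v))

  same-side : ∀ {u v} → p u ≡ p v → ¬ u ~ v
  same-side eq u~v = proj₂ parity-colouring u~v eq

  triangle-free : ∀ {u v w} → u ~ v → u ~ w → ¬ v ~ w
  triangle-free u~v u~w = same-side (trans (p-alternates u~v) (sym (p-alternates u~w)))

  neighbour : ∀ v → ∃[ w ] (v ~ w)
  neighbour v with any? (v ~?_)
  ... | yes found = found
  ... | no none = contradiction
    (closed⇒long (v ∷ []) (λ { (here refl) v~w → contradiction (_ , v~w) none }) (here refl))
    (<⇒≱ (≤-trans (s≤s (s≤s z≤n)) n≥5))

  -- A chosen neighbour; for a leaf, its support vertex.
  par : Fin n → Fin n
  par v = proj₁ (neighbour v)

  par-adjacent : ∀ v → v ~ par v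
  par-adjacent v = proj₂ (neighbour v)

  Leaf : Fin n → Set
  Leaf v = ∀ w → v ~ w → w ≡ par v

  Leaf? : Decidable Leaf
  Leaf? v = all? λ w → (v ~? w) →-dec (w ≟ par v)

  -- Two adjacent leaves would make up a whole component, hence a tree of order 2.
  leaves-nonadjacent : ∀ {x y} → Leaf x → Leaf y → ¬ x ~ y
  leaves-nonadjacent {x} {y} leaf-x leaf-y x~y = contradiction
    (closed⇒long (x ∷ y ∷ []) closed (here refl))
    (<⇒≱ (≤-trans (s≤s (s≤s (s≤s z≤n))) n≥5))
    where
    closed : ∀ {u v} → u ∈ˡ x ∷ y ∷ [] → u ~ v → v ∈ˡ x ∷ y ∷ []
    closed (here refl) x~v = there (here (trans (leaf-x _ x~v) (sym (leaf-x y x~y))))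
    closed (there (here refl)) y~v = here (trans (leaf-y _ y~v) (sym (leaf-y x (~-sym x~y))))

  par-nonleaf : ∀ {l} → Leaf l → ¬ Leaf (par l)
  par-nonleaf {l} leaf leaf′ = leaves-nonadjacent leaf leaf′ (par-adjacent l)

  another-neighbour : ∀ {v} → ¬ Leaf v → ∀ a → ∃[ z ] (v ~ z × z ≢ a)
  another-neighbour {v} ¬leaf a with par v ≟ a
  ... | no par≢a = par v , par-adjacent v , par≢a
  ... | yes refl with ¬∀⟶∃¬ n _ (λ w → (v ~? w) →-dec (w ≟ par v)) ¬leaf
  ... | w , ¬imp = w
    , decidable-stable (v ~? w) (λ v≁w → ¬imp λ v~w → contradiction v~w v≁w)
    , λ w≡ → ¬imp λ _ → w≡

  Pendant : Fin n → Fin n → Set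
  Pendant u l = Leaf l × par l ≡ u

  Pendant? : ∀ u → Decidable (Pendant u)
  Pendant? u l = Leaf? l ×-dec (par l ≟ u)

  pendant-adjacent : ∀ {u l} → Pendant u l → u ~ l
  pendant-adjacent {l = l} (_ , refl) = ~-sym (par-adjacent l)

  pendant-unique : ∀ {u l x} → Pendant u l → x ~ l → x ≡ u
  pendant-unique (leaf , refl) x~l = leaf _ (~-sym x~l)

  Support : Fin n → Set
  Support u = ∃ (Pendant u)

  Support? : Decidable Support
  Support? u = any? (Pendant? u)

  support-nonleaf : ∀ {u} → Support u → ¬ Leaf u
  support-nonleaf (_ , leaf , refl) = par-nonleaf leaf

  supports : Subset n
  supports = ⟦ Support? ⟧

  -- A distinguishing set that omits one leaf per support vertex.

  module OneLeafRemoved where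

    -- A chosen leaf at every support vertex; junk value u elsewhere.
    pendant : Fin n → Fin n
    pendant u with Support? u
    ... | yes (l , _) = l
    ... | no _ = u

    pendant-spec : ∀ u → Pendant u (pendant u) ⊎ (¬ Support u × pendant u ≡ u)
    pendant-spec u with Support? u
    ... | yes (_ , pend) = inj₁ pend
    ... | no ¬support = inj₂ (¬support , refl)

    Removed : Fin n → Set
    Removed v = Leaf v × pendant (par v) ≡ v

    Removed? : Decidable Removed
    Removed? v = Leaf? v ×-dec (pendant (par v) ≟ v)

    kept : Subset n
    kept = ∁ ⟦ Removed? ⟧

    ∈kept : ∀ {v} → ¬ Removed v → v ∈ kept
    ∈kept ¬removed = x∉p⇒x∈∁p (¬removed ∘ ∈⟦⟧⁻ Removed?)

    -- Every support vertex is `par` of a removed leaf, so at least as many vertices are removed as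
    -- there are support vertices.
    ∣kept∣ : ∣ kept ∣ + ∣ supports ∣ ≤ n
    ∣kept∣ = begin
      ∣ kept ∣ + ∣ supports ∣       ≤⟨ +-monoʳ-≤ ∣ kept ∣ (≤-trans (p⊆q⇒∣p∣≤∣q∣ supports⊆) (∣image∣≤ par removed)) ⟩
      ∣ kept ∣ + ∣ removed ∣        ≡⟨ cong (_+ ∣ removed ∣) (∣∁p∣≡n∸∣p∣ removed) ⟩
      n ∸ ∣ removed ∣ + ∣ removed ∣ ≡⟨ m∸n+n≡m (∣p∣≤n removed) ⟩
      n                             ∎
      where
      open ≤-Reasoning
      removed : Subset n
      removed = ⟦ Removed? ⟧
      supports⊆ : supports ⊆ image par removed
      supports⊆ {u} u∈ with pendant-spec u
      ... | inj₁ (leaf , par≡u) = subst (_∈ image par removed) par≡u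
        (∈-image par removed (∈⟦⟧⁺ Removed? (leaf , cong pendant par≡u)))
      ... | inj₂ (¬support , _) = contradiction (∈⟦⟧⁻ Support? u∈) ¬support

    -- Only one leaf is removed per support vertex, so `x` and `y` hang at different ones, and
    -- `par x` is kept because it is no leaf.
    both-removed : ∀ {x y} → x ≢ y → Removed x → Removed y → Resolves kept x y
    both-removed {x} {y} x≢y (leaf-x , eq-x) (leaf-y , eq-y) =
      par x , ∈kept (par-nonleaf leaf-x ∘ proj₁) , inj₂ (par-adjacent x) , λ
        { (inj₁ par≡y) → par-nonleaf leaf-x (subst Leaf (sym par≡y) leaf-y)
        ; (inj₂ y~par) → x≢y (trans (sym eq-x) (trans (cong pendant (leaf-y _ y~par)) eq-y)) }

    one-removed : ∀ {x y} → x ≢ y → Removed x → ¬ Removed y → Resolves kept y x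
    one-removed {x} {y} x≢y (leaf , eq) ¬removed-y with par x ≟ y
    ... | no par≢y = y , ∈kept ¬removed-y , inj₁ refl
      , [ x≢y ∘ sym , (λ x~y → par≢y (sym (leaf y x~y))) ]′
    -- Here `y` is the support vertex of `x`. Its only removed leaf is `x`, so any other neighbour
    -- of `y` is kept.
    ... | yes refl with another-neighbour (par-nonleaf leaf) x
    ... | z , y~z , z≢x = z
      , ∈kept (λ (leaf-z , eq-z) → z≢x (trans (sym eq-z) (trans (cong pendant (sym (leaf-z _ (~-sym y~z)))) eq)))
      , inj₂ y~z
      , [ z≢x , (λ x~z → ~-irrefl (sym (leaf z x~z)) y~z) ]′

    neither-removed : ∀ {x y} → x ≢ y → ¬ Removed x → ¬ Removed y → Distinguishes kept x y
    neither-removed {x} {y} x≢y ¬removed-x ¬removed-y with x ~? y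
    ... | no x≁y = inj₁ (x , ∈kept ¬removed-x , inj₁ refl , [ x≢y , x≁y ∘ ~-sym ]′)
    ... | yes x~y with any? (λ z → (x ~? z) ×-dec ¬? (z ≟ y) ×-dec ¬? (Removed? z))
                     | any? (λ z → (y ~? z) ×-dec ¬? (z ≟ x) ×-dec ¬? (Removed? z))
    ... | yes (z , x~z , z≢y , ¬removed) | _ =
      inj₁ (z , ∈kept ¬removed , inj₂ x~z , [ z≢y , triangle-free x~y x~z ]′)
    ... | no _ | yes (z , y~z , z≢x , ¬removed) =
      inj₂ (z , ∈kept ¬removed , inj₂ y~z , [ z≢x , triangle-free (~-sym x~y) y~z ]′)
    -- Apart from each other, `x` and `y` have at most their removed leaves as neighbours, so the
    -- tree is a path on at most four vertices.
    ... | no none-x | no none-y = contradiction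
      (closed⇒long (x ∷ y ∷ pendant x ∷ pendant y ∷ []) closed (here refl)) (<⇒≱ n≥5)
      where
      neighbours : ∀ {u v} → ¬ (∃[ z ] (u ~ z × z ≢ v × ¬ Removed z)) →
        ∀ {z} → u ~ z → z ≡ v ⊎ z ≡ pendant u
      neighbours {u} {v} none {z} u~z with z ≟ v
      ... | yes z≡v = inj₁ z≡v
      ... | no z≢v with decidable-stable (Removed? z) (λ ¬removed → none (z , u~z , z≢v , ¬removed))
      ... | leaf , eq = inj₂ (trans (sym eq) (cong pendant (sym (leaf _ (~-sym u~z)))))
      xs : List (Fin n)
      xs = x ∷ y ∷ pendant x ∷ pendant y ∷ []
      from-x : ∀ {z} → x ~ z → z ∈ˡ xs
      from-x x~z = [ there ∘ here , there ∘ there ∘ here ]′ (neighbours none-x x~z)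
      from-y : ∀ {z} → y ~ z → z ∈ˡ xs
      from-y y~z = [ here , there ∘ there ∘ there ∘ here ]′ (neighbours none-y y~z)
      closed : ∀ {u v} → u ∈ˡ xs → u ~ v → v ∈ˡ xs
      closed (here refl) = from-x
      closed (there (here refl)) = from-y
      closed (there (there (here refl))) u~v with pendant-spec x
      ... | inj₁ pend = here (pendant-unique pend (~-sym u~v))
      -- Without a leaf at `x`, the junk value makes this list entry `x` again.
      ... | inj₂ (_ , eq) = from-x (subst (_~ _) eq u~v)
      closed (there (there (there (here refl)))) u~v with pendant-spec y
      ... | inj₁ pend = there (here (pendant-unique pend (~-sym u~v)))
      ... | inj₂ (_ , eq) = from-y (subst (_~ _) eq u~v)

    distinguishes : ∀ {x y} → x ≢ y → Distinguishes kept x y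
    distinguishes {x} {y} x≢y with Removed? x | Removed? y
    ... | yes rx | yes ry = inj₁ (both-removed x≢y rx ry)
    ... | yes rx | no ¬ry = inj₂ (one-removed x≢y rx ¬ry)
    ... | no ¬rx | yes ry = inj₁ (one-removed (≢-sym x≢y) ry ¬rx)
    ... | no ¬rx | no ¬ry = neither-removed x≢y ¬rx ¬ry

  -- Two separating sets for a fixed colouring.

  module Coloured (col : Fin n → Bool) where

    Separates : Subset n → Set
    Separates S = ∀ x y → col x ≢ col y → Distinguishes S x y

    TwoSets : Set
    TwoSets = Σ (Bool → Subset n) λ S →
      (∀ q → Separates (S q)) × ∣ S true ∣ + ∣ S false ∣ ≤ n + ∣ supports ∣

    distinct : ∀ {x y} → col x ≢ col y → x ≢ y
    distinct cx≢cy refl = cx≢cy refl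

    IsStarCentre : Fin n → Set
    IsStarCentre u = ∀ z → u ~ z → Leaf z

    -- Stars.

    module StarCase (u : Fin n) (star : IsStarCentre u) where

      spread : ∀ v → v ≡ u ⊎ u ~ v
      spread = closed⇒full closed (inj₁ refl)
        where
        closed : ∀ {v w} → v ≡ u ⊎ u ~ v → v ~ w → w ≡ u ⊎ u ~ w
        closed (inj₁ refl) u~w = inj₂ u~w
        closed {v} (inj₂ u~v) v~w = inj₁ (trans (star v u~v _ v~w) (sym (star v u~v u (~-sym u~v))))

      private
        second : ∃[ z ] (u ~ z × z ≢ par u)
        second = another-neighbour (λ leaf → leaves-nonadjacent leaf (star _ (par-adjacent u)) (par-adjacent u)) (par u)

      l₁ l₂ : Fin n
      l₁ = par u
      l₂ = proj₁ second

      others pair : Subset n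
      others = ∁ ⁅ u ⁆
      pair = ⁅ l₁ ⁆ ∪ ⁅ l₂ ⁆

      -- The leaves are split by colour, and both sets are completed to contain `l₁` and `l₂`. The
      -- colour classes separate leaves of different colours; the centre is separated from a leaf by
      -- whichever of `l₁` and `l₂` is not that leaf. The sizes add up to at most (n - 1) + 2.
      S : Bool → Subset n
      S q = (others ∩ class col q) ∪ (pair ∩ class (not ∘ col) q)

      ∈S : ∀ {q v} → u ~ v → col v ≡ q → v ∈ S q
      ∈S {q} {v} u~v eq = x∈p∪q⁺ (inj₁ (x∈p∩q⁺
        ( x∉p⇒x∈∁p (λ v∈ → ~-irrefl (sym (x∈⁅y⁆⇒x≡y u v∈)) u~v)
        , ∈⟦⟧⁺ (λ v → col v ≟ᵇ q) eq)))

      pair⊆S : ∀ {q v} → u ~ v → v ∈ pair → v ∈ S q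
      pair⊆S {q} {v} u~v v∈ with col v ≟ᵇ q
      ... | yes eq = ∈S u~v eq
      ... | no ≢q = x∈p∪q⁺ (inj₂ (x∈p∩q⁺ (v∈ , ∈⟦⟧⁺ (λ v → not (col v) ≟ᵇ q) (sym (¬-not (≢-sym ≢q))))))

      centre : ∀ {q v} → u ~ v → Resolves (S q) u v
      centre {q} {v} u~v with v ≟ l₁
      ... | no v≢l₁ = l₁ , pair⊆S (par-adjacent u) (x∈p∪q⁺ (inj₁ (x∈⁅x⁆ l₁))) , inj₂ (par-adjacent u)
        , [ v≢l₁ ∘ sym , leaves-nonadjacent (star v u~v) (star l₁ (par-adjacent u)) ]′
      ... | yes refl = l₂ , pair⊆S (proj₁ (proj₂ second)) (x∈p∪q⁺ (inj₂ (x∈⁅x⁆ l₂))) , inj₂ (proj₁ (proj₂ second))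
        , [ proj₂ (proj₂ second) , leaves-nonadjacent (star v u~v) (star l₂ (proj₁ (proj₂ second))) ]′

      selected : ∀ {q x y} → u ~ x → u ~ y → col x ≢ col y → col x ≡ q → Resolves (S q) x y
      selected {x = x} {y} u~x u~y cx≢cy eq =
        x , ∈S u~x eq , inj₁ refl , [ distinct cx≢cy , leaves-nonadjacent (star y u~y) (star x u~x) ]′

      separates : ∀ q → Separates (S q)
      separates q x y cx≢cy with spread x | spread y
      ... | inj₁ refl | inj₁ refl = contradiction refl cx≢cy
      ... | inj₁ refl | inj₂ u~y = inj₁ (centre u~y)
      ... | inj₂ u~x | inj₁ refl = inj₂ (centre u~x)
      ... | inj₂ u~x | inj₂ u~y with col x ≟ᵇ q
      ... | yes eq = inj₁ (selected u~x u~y cx≢cy eq)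
      ... | no cx≢q = inj₂ (selected u~y u~x (≢-sym cx≢cy)
        (trans (¬-not (≢-sym cx≢cy)) (sym (¬-not (≢-sym cx≢q)))))

      twoSets : TwoSets
      twoSets = S , separates , (begin
        ∣ S true ∣ + ∣ S false ∣ ≤⟨ ∣∪∣+∣∪∣≤ (others ∩ class col true) (others ∩ class col false)
            (pair ∩ class (not ∘ col) true) (pair ∩ class (not ∘ col) false)
            (≤-reflexive (∣∩class∣ others col)) (≤-reflexive (∣∩class∣ pair (not ∘ col))) ⟩
        ∣ others ∣ + ∣ pair ∣     ≤⟨ +-monoʳ-≤ ∣ others ∣ (∣p∪q∣≤∣p∣+∣q∣ ⁅ l₁ ⁆ ⁅ l₂ ⁆) ⟩
        ∣ others ∣ + (∣ ⁅ l₁ ⁆ ∣ + ∣ ⁅ l₂ ⁆ ∣)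
          ≡⟨ cong (∣ others ∣ +_) (cong₂ _+_ (∣⁅x⁆∣≡1 l₁) (∣⁅x⁆∣≡1 l₂)) ⟩
        ∣ others ∣ + (1 + 1)      ≡⟨ +-assoc (∣ others ∣) 1 1 ⟨
        ∣ others ∣ + 1 + 1        ≡⟨ cong (λ k → k + 1 + 1) (trans (∣∁p∣≡n∸∣p∣ ⁅ u ⁆) (cong (n ∸_) (∣⁅x⁆∣≡1 u))) ⟩
        n ∸ 1 + 1 + 1             ≡⟨ cong (_+ 1) (m∸n+n≡m (≤-trans (s≤s z≤n) n≥5)) ⟩
        n + 1                     ≡⟨ cong (n +_) (∣⁅x⁆∣≡1 u) ⟨
        n + ∣ ⁅ u ⁆ ∣             ≤⟨ +-monoʳ-≤ n (p⊆q⇒∣p∣≤∣q∣ ⁅u⁆⊆) ⟩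
        n + ∣ supports ∣          ∎)
        where
        open ≤-Reasoning
        ⁅u⁆⊆ : ⁅ u ⁆ ⊆ supports
        ⁅u⁆⊆ v∈ with x∈⁅y⁆⇒x≡y u v∈
        ... | refl = ∈⟦⟧⁺ Support? (par u , star _ (par-adjacent u) ,
          sym (star _ (par-adjacent u) u (~-sym (par-adjacent u))))

    -- Trees other than stars.

    module NoStarCase (no-star : ∀ u → ∃[ z ] (u ~ z × ¬ Leaf z)) where

      inner : Fin n → Fin n
      inner u = proj₁ (no-star u)

      inner-adjacent : ∀ u → u ~ inner u
      inner-adjacent u = proj₁ (proj₂ (no-star u))

      inner-nonleaf : ∀ u → ¬ Leaf (inner u)
      inner-nonleaf u = proj₂ (proj₂ (no-star u))

      Mixed : Fin n → Set
      Mixed u = (∃[ l ] (Pendant u l × col l ≡ col u)) × (∃[ l ] (Pendant u l × col l ≢ col u))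

      Mixed? : Decidable Mixed
      Mixed? u = any? (λ l → Pendant? u l ×-dec (col l ≟ᵇ col u))
           ×-dec any? (λ l → Pendant? u l ×-dec ¬? (col l ≟ᵇ col u))

      mixed⇒support : ∀ {u} → Mixed u → Support u
      mixed⇒support ((l , pend , _) , _) = l , pend

      -- The leaves that count for the side of their support vertex.
      Switched : Fin n → Set
      Switched l = Leaf l × Mixed (par l) × col l ≡ col (par l)

      Switched? : Decidable Switched
      Switched? l = Leaf? l ×-dec Mixed? (par l) ×-dec (col l ≟ᵇ col (par l))

      -- Leaves of different colours at one support vertex make it mixed and thus get different
      -- sides.
      side : Fin n → Bool
      side v with Switched? v
      ... | yes _ = not (p v)
      ... | no _ = p v

      side-switched : ∀ {v} → Switched v → side v ≡ not (p v)
      side-switched {v} sw with Switched? v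
      ... | yes _ = refl
      ... | no ¬sw = contradiction sw ¬sw

      side-unswitched : ∀ {v} → ¬ Switched v → side v ≡ p v
      side-unswitched {v} ¬sw with Switched? v
      ... | yes sw = contradiction sw ¬sw
      ... | no _ = refl

      -- Besides the classes of side, a support vertex u adds one vertex to
      -- one of the two sets: a mixed u adds itself to the opposite side, and
      -- any other u adds an inner neighbour to its own side.
      extra-side : Fin n → Bool
      extra-side u with Mixed? u
      ... | yes _ = not (p u)
      ... | no _ = p u

      extra : Fin n → Fin n
      extra u with Mixed? u
      ... | yes _ = u
      ... | no _ = inner u

      extra-mixed : ∀ {u} → Mixed u → extra-side u ≡ not (p u) × extra u ≡ u
      extra-mixed {u} mixed with Mixed? u
      ... | yes _ = refl , refl
      ... | no ¬mixed = contradiction mixed ¬mixed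

      extra-unmixed : ∀ {u} → ¬ Mixed u → extra-side u ≡ p u × extra u ≡ inner u
      extra-unmixed {u} ¬mixed with Mixed? u
      ... | yes mixed = contradiction mixed ¬mixed
      ... | no _ = refl , refl

      S : Bool → Subset n
      S q = class side q ∪ image extra (supports ∩ class extra-side q)

      ∣S∣ : ∣ S true ∣ + ∣ S false ∣ ≤ n + ∣ supports ∣
      ∣S∣ = ∣∪∣+∣∪∣≤ (class side true) (class side false) (added true) (added false) (≤-reflexive (∣class∣ side))
        (≤-trans (+-mono-≤ (∣image∣≤ extra (supports ∩ class extra-side true))
                           (∣image∣≤ extra (supports ∩ class extra-side false)))
                 (≤-reflexive (∣∩class∣ supports extra-side)))
        where
        added : Bool → Subset n
        added q = image extra (supports ∩ class extra-side q)

      -- Vertices in the set of side `q`, and pairs of non-leaves.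

      module _ (q : Bool) where

        other-side : ∀ {u} → p u ≢ q → q ≡ not (p u)
        other-side pu≢q = ¬-not (≢-sym pu≢q)

        crosses : ∀ {u v} → p u ≢ q → u ~ v → p v ≡ q
        crosses pu≢q u~v = trans (p-alternates u~v) (sym (other-side pu≢q))

        side⊆S : ∀ {v} → side v ≡ q → v ∈ S q
        side⊆S eq = x∈p∪q⁺ (inj₁ (∈⟦⟧⁺ (λ v → side v ≟ᵇ q) eq))

        extra∈S : ∀ {u} → Support u → extra-side u ≡ q → extra u ∈ S q
        extra∈S support eq = x∈p∪q⁺ (inj₂ (∈-image extra (supports ∩ class extra-side q)
          (x∈p∩q⁺ (∈⟦⟧⁺ Support? support , ∈⟦⟧⁺ (λ u → extra-side u ≟ᵇ q) eq))))

        unswitched∈S : ∀ {v} → ¬ Switched v → p v ≡ q → v ∈ S q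
        unswitched∈S ¬sw pv≡q = side⊆S (trans (side-unswitched ¬sw) pv≡q)

        nonleaf∈S : ∀ {v} → ¬ Leaf v → p v ≡ q → v ∈ S q
        nonleaf∈S ¬leaf = unswitched∈S (¬leaf ∘ proj₁)

        switched∈S : ∀ {l} → Switched l → p (par l) ≡ q → l ∈ S q
        switched∈S {l} sw eq = side⊆S (trans (side-switched sw) (trans (sym (p-alternates (par-adjacent l))) eq))

        -- For its own side `u` belongs as a non-leaf, for the other side as its own extra vertex.
        mixed∈S : ∀ {u} → Mixed u → u ∈ S q
        mixed∈S {u} mixed with p u ≟ᵇ q
        ... | yes pu≡q = nonleaf∈S (support-nonleaf (mixed⇒support mixed)) pu≡q
        ... | no pu≢q = subst (_∈ S q) (proj₂ (extra-mixed mixed))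
          (extra∈S (mixed⇒support mixed) (trans (proj₁ (extra-mixed mixed)) (sym (other-side pu≢q))))

        -- If `u` is off side `q`, its inner neighbour is a non-leaf on side `q`. If `u` is on side
        -- `q` and unmixed, the inner neighbour is its extra vertex.
        inner∈S : ∀ {u} → Support u → ¬ Mixed u ⊎ p u ≢ q → inner u ∈ S q
        inner∈S {u} _ (inj₂ pu≢q) = nonleaf∈S (inner-nonleaf u) (crosses pu≢q (inner-adjacent u))
        inner∈S {u} support (inj₁ ¬mixed) with p u ≟ᵇ q
        ... | yes pu≡q = subst (_∈ S q) (proj₂ (extra-unmixed ¬mixed))
          (extra∈S support (trans (proj₁ (extra-unmixed ¬mixed)) pu≡q))
        ... | no pu≢q = nonleaf∈S (inner-nonleaf u) (crosses pu≢q (inner-adjacent u))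

        -- A mixed support vertex is in both sets. Otherwise the leaf is not switched, and either it
        -- or its support vertex is on side `q`.
        leaf-or-par∈S : ∀ {l} → Leaf l → l ∈ S q ⊎ par l ∈ S q
        leaf-or-par∈S {l} leaf with Mixed? (par l) | p l ≟ᵇ q
        ... | yes mixed | _ = inj₂ (mixed∈S mixed)
        ... | no ¬mixed | yes pl≡q = inj₁ (unswitched∈S (¬mixed ∘ proj₁ ∘ proj₂) pl≡q)
        ... | no _ | no pl≢q = inj₂ (nonleaf∈S (par-nonleaf leaf) (crosses pl≢q (par-adjacent l)))

        -- The neighbours of `y` are on side `q`, where only switched leaves can be missing, and
        -- these hang at mixed vertices.
        neighbour∈S : ∀ {y z} → p y ≢ q → ¬ Mixed y → y ~ z → z ∈ S q
        neighbour∈S {y} {z} py≢q ¬mixed y~z = unswitched∈S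
          (λ (leaf , mixed , _) → ¬mixed (subst Mixed (sym (leaf y (~-sym y~z))) mixed))
          (crosses py≢q y~z)

        -- If `y` is mixed, its leaf of the other colour stays on side `q` and is adjacent to `y`
        -- alone. Otherwise all neighbours of `y` are in the set, and one other than `x` is on the
        -- side of `x`, hence not adjacent to it.
        resolve-main-off : ∀ {x y} → ¬ Leaf x → ¬ Leaf y → p x ≡ q → p y ≢ q → Resolves (S q) y x
        resolve-main-off {x} {y} ¬leaf-x ¬leaf-y px≡q py≢q with Mixed? y
        ... | yes (_ , l , pend@(leaf , refl) , c≢) =
          l , unswitched∈S (c≢ ∘ proj₂ ∘ proj₂) (crosses py≢q (pendant-adjacent pend)) , inj₂ (pendant-adjacent pend)
          , λ { (inj₁ refl) → ¬leaf-x leaf ; (inj₂ x~l) → py≢q (trans (cong p (sym (pendant-unique pend x~l))) px≡q) }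
        ... | no ¬mixed with another-neighbour ¬leaf-y x
        ... | z , y~z , z≢x = z , neighbour∈S py≢q ¬mixed y~z , inj₂ y~z
          , [ z≢x , same-side (trans px≡q (sym (crosses py≢q y~z))) ]′

        -- A mixed vertex is in the set and not adjacent to the other, which is on the same side. If
        -- both are unmixed, two neighbours of `x` are in the set, and without 4-cycles `y` cannot
        -- be adjacent to both.
        off-off : ∀ {x y} → x ≢ y → ¬ Leaf x → p x ≢ q → p y ≢ q → Distinguishes (S q) x y
        off-off {x} {y} x≢y ¬leaf-x px≢q py≢q with Mixed? x | Mixed? y
        ... | yes mixed | _ = inj₁ (x , mixed∈S mixed , inj₁ refl , [ x≢y , px≢q ∘ crosses py≢q ]′)
        ... | no _ | yes mixed = inj₂ (y , mixed∈S mixed , inj₁ refl , [ ≢-sym x≢y , py≢q ∘ crosses px≢q ]′)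
        ... | no ¬mixed | no _ with another-neighbour ¬leaf-x (par x)
        ... | b , x~b , b≢a with y ~? b
        ... | no y≁b = inj₁ (b , neighbour∈S px≢q ¬mixed x~b , inj₂ x~b
          , [ (λ { refl → py≢q (crosses px≢q x~b) }) , y≁b ]′)
        ... | yes y~b = inj₁ (par x , neighbour∈S px≢q ¬mixed (par-adjacent x) , inj₂ (par-adjacent x)
          , [ (λ { refl → py≢q (crosses px≢q (par-adjacent x)) })
            , no-4-cycle G acyclic x≢y b≢a x~b (par-adjacent x) y~b ]′)

        nonleaf-pair : ∀ {x y} → x ≢ y → ¬ Leaf x → ¬ Leaf y → Distinguishes (S q) x y
        nonleaf-pair {x} {y} x≢y ¬leaf-x ¬leaf-y with p x ≟ᵇ q | p y ≟ᵇ q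
        ... | yes px≡q | yes py≡q = inj₁ (x , nonleaf∈S ¬leaf-x px≡q , inj₁ refl
          , [ x≢y , same-side (trans py≡q (sym px≡q)) ]′)
        ... | yes px≡q | no py≢q = inj₂ (resolve-main-off ¬leaf-x ¬leaf-y px≡q py≢q)
        ... | no px≢q | yes py≡q = inj₁ (resolve-main-off ¬leaf-y ¬leaf-x py≡q px≢q)
        ... | no px≢q | no py≢q = off-off x≢y ¬leaf-x px≢q py≢q

        -- Pairs that contain a leaf.

        resolve-leaf : ∀ {x y} → Leaf x → Leaf y → x ≢ y → x ∈ S q → Resolves (S q) x y
        resolve-leaf {x} leaf-x leaf-y x≢y x∈S =
          x , x∈S , inj₁ refl , [ x≢y , leaves-nonadjacent leaf-y leaf-x ]′

        -- The two leaves make `u` mixed, so `x` is switched and `y` is not, and exactly one of them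
        -- counts for side `q`.
        sibling-pair : ∀ {u x y} → Pendant u x → Pendant u y → col x ≡ col u → col y ≢ col u →
          Distinguishes (S q) x y
        sibling-pair {u} {x} {y} pend-x@(leaf-x , refl) pend-y@(leaf-y , par≡) cx≡ cy≢ with p u ≟ᵇ q
        ... | yes pu≡q = inj₁ (resolve-leaf leaf-x leaf-y (λ { refl → cy≢ cx≡ })
          (switched∈S (leaf-x , ((x , pend-x , cx≡) , (y , pend-y , cy≢)) , cx≡) pu≡q))
        ... | no pu≢q = inj₂ (resolve-leaf leaf-y leaf-x (λ { refl → cy≢ cx≡ })
          (unswitched∈S (λ (_ , _ , c≡) → cy≢ (trans c≡ (cong col par≡))) (crosses pu≢q (pendant-adjacent pend-y))))

        leaf-pair : ∀ {x y} → Leaf x → Leaf y → col x ≢ col y → Distinguishes (S q) x y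
        leaf-pair {x} {y} leaf-x leaf-y cx≢cy with par x ≟ par y
        ... | yes par≡ with col x ≟ᵇ col (par x)
        ... | yes cx≡ = sibling-pair (leaf-x , refl) (leaf-y , sym par≡) cx≡ (λ cy≡ → cx≢cy (trans cx≡ (sym cy≡)))
        ... | no cx≢ = swap (sibling-pair (leaf-y , sym par≡) (leaf-x , refl)
          (trans (¬-not (≢-sym cx≢cy)) (sym (¬-not (≢-sym cx≢)))) cx≢)
        leaf-pair {x} {y} leaf-x leaf-y cx≢cy | no par≢ with leaf-or-par∈S leaf-x
        ... | inj₁ x∈S = inj₁ (resolve-leaf leaf-x leaf-y (distinct cx≢cy) x∈S)
        ... | inj₂ par∈S = inj₁ (par x , par∈S , inj₂ (par-adjacent x)
          , [ (λ par≡y → par-nonleaf leaf-x (subst Leaf (sym par≡y) leaf-y)) , par≢ ∘ leaf-y (par x) ]′)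

        -- If `par x` is mixed and on side `q`, a leaf of its own colour is in the set and differs
        -- from `x`. In the other cases the inner neighbour of `par x` is in the set, and `x` is
        -- adjacent to `par x` alone.
        leaf-par : ∀ {x} → Leaf x → col x ≢ col (par x) → Resolves (S q) (par x) x
        leaf-par {x} leaf cx≢ with Mixed? (par x) | p (par x) ≟ᵇ q
        ... | yes mixed@((l , pend@(leaf-l , par≡) , cl≡) , _) | yes pu≡q =
          l , switched∈S (leaf-l , subst Mixed (sym par≡) mixed , trans cl≡ (cong col (sym par≡)))
            (trans (cong p par≡) pu≡q)
          , inj₂ (pendant-adjacent pend)
          , [ (λ { refl → cx≢ cl≡ }) , leaves-nonadjacent leaf leaf-l ]′
        ... | no ¬mixed | _ = inner _ , inner∈S (x , leaf , refl) (inj₁ ¬mixed) , inj₂ (inner-adjacent _)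
          , [ (λ eq → inner-nonleaf _ (subst Leaf (sym eq) leaf))
            , (λ x~ → ~-irrefl (sym (leaf _ x~)) (inner-adjacent _)) ]′
        ... | yes _ | no pu≢q = inner _ , inner∈S (x , leaf , refl) (inj₂ pu≢q) , inj₂ (inner-adjacent _)
          , [ (λ eq → inner-nonleaf _ (subst Leaf (sym eq) leaf))
            , (λ x~ → ~-irrefl (sym (leaf _ x~)) (inner-adjacent _)) ]′

        leaf-nonleaf : ∀ {x y} → Leaf x → ¬ Leaf y → col x ≢ col y → Distinguishes (S q) x y
        leaf-nonleaf {x} {y} leaf-x ¬leaf-y cx≢cy with par x ≟ y
        ... | yes refl = inj₂ (leaf-par leaf-x cx≢cy)
        ... | no par≢y with leaf-or-par∈S leaf-x
        ... | inj₁ x∈S = inj₁ (x , x∈S , inj₁ refl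
          , [ distinct cx≢cy , (λ y~x → par≢y (sym (leaf-x y (~-sym y~x)))) ]′)
        ... | inj₂ par∈S with y ~? par x
        ... | no y≁par = inj₁ (par x , par∈S , inj₂ (par-adjacent x) , [ par≢y , y≁par ]′)
        -- Now `par x` is a common neighbour and no witness. Either `y` is in the set, or `y` is
        -- unmixed and off side `q`, and a neighbour of `y` other than `par x` serves.
        ... | yes y~par = inj₂ y-resolved
          where
          y-itself : y ∈ S q → Resolves (S q) y x
          y-itself y∈S = y , y∈S , inj₁ refl , [ distinct (≢-sym cx≢cy) , (λ x~y → par≢y (sym (leaf-x y x~y))) ]′
          y-resolved : Resolves (S q) y x
          y-resolved with p y ≟ᵇ q | Mixed? y
          ... | yes py≡q | _ = y-itself (nonleaf∈S ¬leaf-y py≡q)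
          ... | no _ | yes mixed = y-itself (mixed∈S mixed)
          ... | no py≢q | no ¬mixed with another-neighbour ¬leaf-y (par x)
          ... | z , y~z , z≢par = z , neighbour∈S py≢q ¬mixed y~z , inj₂ y~z
            , [ (λ { refl → par≢y (sym (leaf-x y (~-sym y~z))) }) , z≢par ∘ leaf-x z ]′

        separates : Separates (S q)
        separates x y cx≢cy with Leaf? x | Leaf? y
        ... | yes leaf-x | yes leaf-y = leaf-pair leaf-x leaf-y cx≢cy
        ... | yes leaf-x | no ¬leaf-y = leaf-nonleaf leaf-x ¬leaf-y cx≢cy
        ... | no ¬leaf-x | yes leaf-y = swap (leaf-nonleaf leaf-y ¬leaf-x (≢-sym cx≢cy))
        ... | no ¬leaf-x | no ¬leaf-y = nonleaf-pair (distinct cx≢cy) ¬leaf-x ¬leaf-y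

      twoSets : TwoSets
      twoSets = S , separates , ∣S∣

    twoSets : TwoSets
    twoSets with any? (λ u → all? (λ z → (u ~? z) →-dec Leaf? z))
    ... | yes (u , star) = StarCase.twoSets u star
    ... | no none = NoStarCase.twoSets λ u →
      let z , ¬imp = ¬∀⟶∃¬ n _ (λ z → (u ~? z) →-dec Leaf? z) (λ star → none (u , star))
      in z , decidable-stable (u ~? z) (λ u≁z → ¬imp λ u~z → contradiction u~z u≁z) , λ leaf → ¬imp λ _ → leaf

    -- The smallest of the three sets.

    small-separating : ∃[ S ] (Separates S × 3 * ∣ S ∣ ≤ 2 * n)
    small-separating = [ (λ small → S true , separates true , small)
      , [ (λ small → S false , separates false , small)
        , (λ small → kept , (λ _ _ → distinguishes ∘ distinct) , small) ]′ ]′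
      (some-≤-average (∣ S true ∣) (∣ S false ∣) (∣ kept ∣) n sum≤)
      where
      open ≤-Reasoning
      open OneLeafRemoved
      S : Bool → Subset n
      S = proj₁ twoSets
      separates : ∀ q → Separates (S q)
      separates = proj₁ (proj₂ twoSets)
      sum≤ : ∣ S true ∣ + ∣ S false ∣ + ∣ kept ∣ ≤ 2 * n
      sum≤ = begin
        ∣ S true ∣ + ∣ S false ∣ + ∣ kept ∣ ≤⟨ +-mono-≤ (proj₂ (proj₂ twoSets)) ≤-refl ⟩
        n + ∣ supports ∣ + ∣ kept ∣         ≡⟨ +-assoc n (∣ supports ∣) (∣ kept ∣) ⟩
        n + (∣ supports ∣ + ∣ kept ∣)       ≡⟨ cong (n +_) (+-comm (∣ supports ∣) (∣ kept ∣)) ⟩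
        n + (∣ kept ∣ + ∣ supports ∣)       ≤⟨ +-monoʳ-≤ n ∣kept∣ ⟩
        n + n                               ≡⟨ cong (n +_) (+-comm 0 n) ⟩
        2 * n                               ∎

-- Existence of the minimum and of the maximum over colourings.

isRed : Color → Bool
isRed red = true
isRed blue = false

fromBool : Bool → Color
fromBool true = red
fromBool false = blue

fromBool∘isRed : ∀ c → fromBool (isRed c) ≡ c
fromBool∘isRed red = refl
fromBool∘isRed blue = refl

_≟ᶜ_ : (c d : Color) → Dec (c ≡ d)
red ≟ᶜ red = yes refl
red ≟ᶜ blue = no λ ()
blue ≟ᶜ red = no λ ()
blue ≟ᶜ blue = yes refl

module _ (G : Graph n) where
  open Graph G

  Separating? : ∀ c → Decidable (Separating G c)
  Separating? c S = all? λ r → all? λ b →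
    (c r ≟ᶜ red) →-dec (c b ≟ᶜ blue) →-dec ¬? (≡-dec _≟ᵇ_ (N[ r ] ∩ S) (N[ b ] ∩ S))

  SepRB-exists : ∀ c {S} → Separating G c S → ∃ (SepRB G c)
  SepRB-exists c {S} sep = least
    (λ k → anySubset? λ S → Separating? c S ×-dec (∣ S ∣ ≟ⁿ k)) ∣ S ∣ (S , sep , refl)

  -- Colourings are functions, so pointwise agreement with some `coloring R` is all that is
  -- available in the comparison with the maximum.
  SepRB-cong-≤ : ∀ {c d} → (∀ v → c v ≡ d v) → ∀ {j k} → SepRB G c j → SepRB G d k → j ≤ k
  SepRB-cong-≤ c≗d (_ , minimal) ((S , sep , ∣S∣≡k) , _) = minimal _
    (S , (λ r b cr cb → sep r b (trans (sym (c≗d r)) cr) (trans (sym (c≗d b)) cb)) , ∣S∣≡k)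

  coloring : Subset n → Coloring n
  coloring R v = fromBool (lookup R v)

  coloring-surjective : ∀ c v → c v ≡ coloring (tabulate (isRed ∘ c)) v
  coloring-surjective c v = trans (sym (fromBool∘isRed (c v)))
    (cong fromBool (sym (lookup∘tabulate (isRed ∘ c) v)))

  -- Separability of every colouring makes the minimum a total function of the set of red vertices,
  -- and such a function attains its maximum over subsets.
  MaxSepRB-exists : (∀ c → ∃ (Separating G c)) → ∃ (MaxSepRB G)
  MaxSepRB-exists separable = sep R , (coloring R , is-sep R) , λ k (c , sep-c) →
    let R′ = tabulate (isRed ∘ c)
    in ≤-trans (SepRB-cong-≤ (coloring-surjective c) sep-c (is-sep R′)) (R-max R′)
    where
    sepRB : ∀ R → ∃ (SepRB G (coloring R))
    sepRB R = SepRB-exists (coloring R) (proj₂ (separable (coloring R)))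
    sep : Subset n → ℕ
    sep R = proj₁ (sepRB R)
    is-sep : ∀ R → SepRB G (coloring R) (sep R)
    is-sep R = proj₂ (sepRB R)
    R : Subset n
    R = proj₁ (maximalSubset sep)
    R-max : ∀ R′ → sep R′ ≤ sep R
    R-max = proj₂ (maximalSubset sep)

corollary19 : ∀ (n : ℕ) (T : Graph n) → Graph.IsTree T → n ≥ 5 →
    ∃[ m ] (MaxSepRB T m × 3 * m ≤ 2 * n)
corollary19 n T (_ , connected , acyclic) n≥5 = m , max , (begin
  -- `m` is the minimum for a maximising colouring, and `S` is a small separating set for that same
  -- colouring.
  3 * m     ≤⟨ *-monoʳ-≤ 3 (proj₂ (proj₂ (proj₁ max)) _ (S , sep , refl)) ⟩
  3 * ∣ S ∣ ≤⟨ small ⟩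
  2 * n     ∎)
  where
  open ≤-Reasoning
  separating : ∀ c → ∃[ S ] (Separating T c S × 3 * ∣ S ∣ ≤ 2 * n)
  separating c =
    let S , separates , small = Coloured.small-separating T acyclic connected n≥5 (isRed ∘ c)
    in S , (λ r b cr cb → Distinguishing.distinguishes⇒≢ T (separates r b λ eq →
         contradiction (trans (sym (cong isRed cr)) (trans eq (cong isRed cb))) λ ())) , small
  maximum : ∃ (MaxSepRB T)
  maximum = MaxSepRB-exists T λ c → let S , sep , _ = separating c in S , sep
  m : ℕ
  m = proj₁ maximum
  max : MaxSepRB T m
  max = proj₂ maximum
  chosen : ∃[ S ] (Separating T (proj₁ (proj₁ max)) S × 3 * ∣ S ∣ ≤ 2 * n)
  chosen = separating _
  S : Subset n
  S = proj₁ chosen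
  sep : Separating T (proj₁ (proj₁ max)) S
  sep = proj₁ (proj₂ chosen)
  small : 3 * ∣ S ∣ ≤ 2 * n
  small = proj₂ (proj₂ chosen)
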